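{- For any positive integers $m$ and $s_1,\ldots,s_m$ there is a constant $c=c(s_1,\ldots,s_m)$ such that the following holds: if $n=p_1^{s_1}\cdots p_m^{s_m}$ with primes $p_1<p_2<\cdots<p_m$ and $p_1>c$, then the $n\times n$ square has no perfect Mondrian partition.
   Context: A Mondrian partition of an $n\times n$ square ($n$ a positive integer) is a dissection of the square into $k\ge 2$ non-overlapping rectangles with positive integer side lengths which are pairwise non-congruent (rectangles of dimensions $a\times b$ and $b\times a$ count as congruent). It is perfect if all its rectangles have the same area (i.e., its defect, the difference between the largest and smallest areas, is $0$). -}

module Defs where

open import Data.Nat using (ℕ; _+_; _*_; _^_; _≤_; _<_)
open import Data.Fin using (Fin)
open import Data.Product using (∃-syntax; _×_)
open import Data.Sum using (_⊎_)
open import Data.Vec.Functional using (foldr)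
open import Relation.Nullary using (¬_)
open import Relation.Binary.PropositionalEquality using (_≡_; _≢_)

-- The axis-parallel rectangle [x , x + width] × [y , y + height].  Corners may
-- be taken integral: in a dissection of [0 , n]² into integer-sided rectangles,
-- following adjacent rectangles to the left (resp. down) to the boundary writes
-- each corner coordinate as a sum of side lengths.
record Rectangle : Set where
  field
    x y          : ℕ
    width height : ℕ
    width>0      : 0 < width
    height>0     : 0 < height

  area : ℕ
  area = width * height

open Rectangle public

-- The rectangle contains the unit cell [i , i + 1] × [j , j + 1].
ContainsCell : Rectangle → ℕ → ℕ → Set
ContainsCell R i j = (x R ≤ i × i < x R + width R) × (y R ≤ j × j < y R + height R)

Congruent : Rectangle → Rectangle → Set
Congruent R S = (width R ≡ width S × height R ≡ height S)
              ⊎ (width R ≡ height S × height R ≡ width S)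

record MondrianPartition (n : ℕ) : Set where
  field
    k    : ℕ
    k≥2  : 2 ≤ k
    rect : Fin k → Rectangle

    inside         : ∀ a → x (rect a) + width (rect a) ≤ n × y (rect a) + height (rect a) ≤ n
    covering       : ∀ i j → i < n → j < n → ∃[ a ] ContainsCell (rect a) i j
    nonOverlapping : ∀ a b → a ≢ b → ∀ i j → ¬ (ContainsCell (rect a) i j × ContainsCell (rect b) i j)
    nonCongruent   : ∀ a b → a ≢ b → ¬ Congruent (rect a) (rect b)

Perfect : ∀ {n} → MondrianPartition n → Set
Perfect P = ∀ a b → area (rect a) ≡ area (rect b)
  where open MondrianPartition P

primePowerProduct : ∀ {m} → (p s : Fin m → ℕ) → ℕ
primePowerProduct p s = foldr _*_ 1 (λ i → p i ^ s i)

{-# OPTIONS --safe #-}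
-- If k tiles of common area A dissect the n × n square, then k · A = n².
-- Tiles of equal area and equal width are congruent, so the widths are k distinct
-- divisors of n², and k is bounded in terms of the exponents of n alone.  On the
-- other hand k ≥ 2 is itself a divisor of n², so it is at least the smallest
-- prime factor of n.
module Submission where

open import Data.Nat using (ℕ; zero; suc; _+_; _*_; _^_; _∸_; _≤_; _<_; z≤n; s≤s; >-nonZero)
open import Data.Nat.Coprimality using (coprime-divisor)
open import Data.Nat.Divisibility using (_∣_; _∣?_; divides; ∣-trans; m∣m*n; n∣m*n; ∣1⇒≡1; ∣⇒≤; *-cancelˡ-∣)
open import Data.Nat.ListAction using (product)
open import Data.Nat.ListAction.Properties using (product-++)
open import Data.Nat.Primality using (Prime; prime⇒irreducible; prime⇒nonZero)
open import Data.Nat.Properties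
open import Data.Fin as Fin using (Fin; toℕ; fromℕ<; remQuot; combine; cast)
import Data.Fin.Properties as Finₚ
open import Data.Fin.Permutation using (↔⇒≡)
open import Data.List using (List; []; _∷_; _++_; length; map; replicate)
open import Data.List.Membership.Propositional using (_∈_)
open import Data.List.Membership.Propositional.Properties using (∈-++⁺ˡ; ∈-++⁺ʳ; ∈-map⁺)
import Data.List.Membership.Setoid.Properties as Membershipₚ
open import Data.List.Properties using (length-++; length-map; length-replicate)
open import Data.List.Relation.Unary.All as All using (All; []; _∷_)
import Data.List.Relation.Unary.All.Properties as Allₚ
open import Data.List.Relation.Unary.Any as Any using (Any; here; there)
open import Data.Product using (∃-syntax; _×_; _,_; proj₁; proj₂; uncurry)
open import Data.Product.Properties using (,-injective)
open import Data.Sum using (_⊎_; inj₁; inj₂; [_,_]′)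
open import Data.Vec.Functional using (foldr)
open import Function using (_∘_; mk⤖; Injective; StrictlySurjective)
open import Function.Consequences.Propositional using (strictlySurjective⇒surjective)
open import Function.Construct.Composition using (_↔-∘_)
open import Function.Construct.Symmetry using (↔-sym)
open import Function.Properties.Bijection using (⤖⇒↔)
open import Relation.Nullary using (¬_; yes; no; contradiction)
open import Relation.Nullary.Decidable using (decidable-stable)
open import Relation.Binary.PropositionalEquality using (_≡_; refl; sym; trans; cong; cong₂; subst; setoid; module ≡-Reasoning)
open import Defs

-- A prime that does not divide `d` is coprime to `d`, and Euclid's lemma then removes it from the
-- multiple. Both inductions over lists of primes below peel off one prime this way.
∣prime*⇒prime∣⊎∣ : ∀ {p d N} → Prime p → d ∣ p * N → p ∣ d ⊎ d ∣ N
∣prime*⇒prime∣⊎∣ {p} {d} {N} pp d∣pN with p ∣? d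
... | yes p∣d = inj₁ p∣d
... | no  p∤d = inj₂ (coprime-divisor coprime d∣pN)
  where
  coprime : ∀ {e} → e ∣ d × e ∣ p → e ≡ 1
  coprime (e∣d , e∣p) with prime⇒irreducible pp e∣p
  ... | inj₁ e≡1  = e≡1
  ... | inj₂ refl = contradiction e∣d p∤d

-- Choices are made per list position, not per exponent, so repeated primes give repeated entries.
-- This is harmless: only an upper bound on the number of divisors is wanted.
subproducts : List ℕ → List ℕ
subproducts []       = 1 ∷ []
subproducts (p ∷ ps) = subproducts ps ++ map (p *_) (subproducts ps)

length-subproducts : ∀ ps → length (subproducts ps) ≡ 2 ^ length ps
length-subproducts []       = refl
length-subproducts (p ∷ ps) = begin
  length (qs ++ map (p *_) qs)       ≡⟨ length-++ qs ⟩
  length qs + length (map (p *_) qs) ≡⟨ cong (length qs +_) (length-map (p *_) qs) ⟩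
  length qs + length qs              ≡⟨ cong (length qs +_) (sym (+-identityʳ _)) ⟩
  2 * length qs                      ≡⟨ cong (2 *_) (length-subproducts ps) ⟩
  2 * 2 ^ length ps                  ∎
  where
  open ≡-Reasoning
  qs = subproducts ps

-- If `p` divides `d`, cancelling it leaves a divisor of the remaining product, and `d` lies in the
-- half multiplied by `p`; otherwise `d` lies in the other half.
∣product⇒∈subproducts : ∀ {ps d} → All Prime ps → d ∣ product ps → d ∈ subproducts ps
∣product⇒∈subproducts []         d∣1 = here (∣1⇒≡1 d∣1)
∣product⇒∈subproducts {p ∷ ps} (pp ∷ pps) d∣ with ∣prime*⇒prime∣⊎∣ pp d∣
... | inj₂ d∣ps = ∈-++⁺ˡ (∣product⇒∈subproducts pps d∣ps)
... | inj₁ (divides e refl) = ∈-++⁺ʳ (subproducts ps)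
  (subst (_∈ map (p *_) (subproducts ps)) (*-comm p e)
    (∈-map⁺ (p *_) (∣product⇒∈subproducts pps e∣ps)))
  where
  e∣ps : e ∣ product ps
  e∣ps = *-cancelˡ-∣ p {{prime⇒nonZero pp}} (subst (_∣ p * product ps) (*-comm e p) d∣)

∣product⇒≡1⊎any∣ : ∀ {ps d} → All Prime ps → d ∣ product ps → d ≡ 1 ⊎ Any (_∣ d) ps
∣product⇒≡1⊎any∣ []         d∣1 = inj₁ (∣1⇒≡1 d∣1)
∣product⇒≡1⊎any∣ (pp ∷ pps) d∣ with ∣prime*⇒prime∣⊎∣ pp d∣
... | inj₁ p∣d = inj₂ (here p∣d)
... | inj₂ d∣ps with ∣product⇒≡1⊎any∣ pps d∣ps
...   | inj₁ d≡1 = inj₁ d≡1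
...   | inj₂ any = inj₂ (there any)

-- Listing the primes with multiplicity lets the exponents enter the bound only through the length
-- of the list.
factors : ∀ {m} → (p s : Fin m → ℕ) → List ℕ
factors p s = foldr _++_ [] (λ i → replicate (s i) (p i))

product-replicate : ∀ n p → product (replicate n p) ≡ p ^ n
product-replicate zero    p = refl
product-replicate (suc n) p = cong (p *_) (product-replicate n p)

product-factors : ∀ {m} (p s : Fin m → ℕ) → product (factors p s) ≡ primePowerProduct p s
product-factors {zero}  p s = refl
product-factors {suc m} p s = trans (product-++ (replicate (s Fin.zero) (p Fin.zero)) _)
  (cong₂ _*_ (product-replicate (s Fin.zero) (p Fin.zero))
             (product-factors (p ∘ Fin.suc) (s ∘ Fin.suc)))

length-factors : ∀ {m} (p s : Fin m → ℕ) → length (factors p s) ≡ foldr _+_ 0 s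
length-factors {zero}  p s = refl
length-factors {suc m} p s = trans (length-++ (replicate (s Fin.zero) (p Fin.zero)))
  (cong₂ _+_ (length-replicate (s Fin.zero)) (length-factors (p ∘ Fin.suc) (s ∘ Fin.suc)))

all-factors : ∀ {m} {Q : ℕ → Set} (p s : Fin m → ℕ) → (∀ i → Q (p i)) → All Q (factors p s)
all-factors {zero}  p s q = []
all-factors {suc m} p s q = Allₚ.++⁺ (Allₚ.replicate⁺ (s Fin.zero) (q Fin.zero))
  (all-factors (p ∘ Fin.suc) (s ∘ Fin.suc) (q ∘ Fin.suc))

-- Enumerates the unit cells of `R`: an index below `width R * height R` splits into a column offset
-- and a row offset.
cell : (R : Rectangle) → Fin (area R) → ℕ × ℕ
cell R t = x R + toℕ (proj₁ uv) , y R + toℕ (proj₂ uv)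
  where uv = remQuot {width R} (height R) t

cell-contained : ∀ R t → uncurry (ContainsCell R) (cell R t)
cell-contained R t =
  (m≤m+n _ _ , +-monoʳ-< (x R) (Finₚ.toℕ<n (proj₁ uv))) ,
  (m≤m+n _ _ , +-monoʳ-< (y R) (Finₚ.toℕ<n (proj₂ uv)))
  where uv = remQuot {width R} (height R) t

cell-injective : ∀ R → Injective _≡_ _≡_ (cell R)
cell-injective R {t} {t′} eq = begin
  t                             ≡⟨ Finₚ.combine-remQuot {width R} (height R) t ⟨
  uncurry combine (split t)     ≡⟨ cong₂ combine u≡u′ v≡v′ ⟩
  uncurry combine (split t′)    ≡⟨ Finₚ.combine-remQuot {width R} (height R) t′ ⟩
  t′                            ∎
  where
  open ≡-Reasoning
  split = remQuot {width R} (height R)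
  u≡u′ = Finₚ.toℕ-injective (+-cancelˡ-≡ (x R) _ _ (proj₁ (,-injective eq)))
  v≡v′ = Finₚ.toℕ-injective (+-cancelˡ-≡ (y R) _ _ (proj₂ (,-injective eq)))

offset : ∀ {a i l} → a ≤ i → i < a + l → ∃[ u ] a + toℕ {l} u ≡ i
offset {a} {i} {l} a≤i i<a+l =
  fromℕ< i∸a<l , trans (cong (a +_) (Finₚ.toℕ-fromℕ< i∸a<l)) (m+[n∸m]≡n a≤i)
  where
  i∸a<l : i ∸ a < l
  i∸a<l = +-cancelˡ-< a _ _ (subst (_< a + l) (sym (m+[n∸m]≡n a≤i)) i<a+l)

cell-surjective : ∀ R {i j} → ContainsCell R i j → ∃[ t ] cell R t ≡ (i , j)
cell-surjective R ((x≤i , i<) , (y≤j , j<)) with offset x≤i i< | offset y≤j j<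
... | u , refl | v , refl =
  combine u v , cong (λ (u , v) → x R + toℕ u , y R + toℕ v) (Finₚ.remQuot-combine u v)

module _ {n} (P : MondrianPartition n) where
  open MondrianPartition P

  containing-tile-unique : ∀ {a b i j} →
    ContainsCell (rect a) i j → ContainsCell (rect b) i j → a ≡ b
  containing-tile-unique {a} {b} ∈a ∈b =
    decidable-stable (a Finₚ.≟ b) (λ a≢b → nonOverlapping a b a≢b _ _ (∈a , ∈b))

  -- Double counting: the pairs of a tile and a cell index within it biject with the cells of the
  -- square. Fixing one `A` makes the domain a plain product, at the price of casts along `areas`.
  k*A≡n*n : ∀ {A} → (∀ a → area (rect a) ≡ A) → k * A ≡ n * n
  k*A≡n*n {A} areas =
    ↔⇒≡ (↔-sym Finₚ.*↔× ↔-∘ (⤖⇒↔ (mk⤖ (place-injective ,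
      strictlySurjective⇒surjective place-surjective)) ↔-∘ Finₚ.*↔×))
    where
    cellOf : Fin k × Fin A → ℕ × ℕ
    cellOf (a , t) = cell (rect a) (cast (sym (areas a)) t)

    contained : ∀ z → uncurry (ContainsCell (rect (proj₁ z))) (cellOf z)
    contained (a , t) = cell-contained (rect a) (cast (sym (areas a)) t)

    col<n : ∀ z → proj₁ (cellOf z) < n
    col<n z = <-≤-trans (proj₂ (proj₁ (contained z))) (proj₁ (inside (proj₁ z)))

    row<n : ∀ z → proj₂ (cellOf z) < n
    row<n z = <-≤-trans (proj₂ (proj₂ (contained z))) (proj₂ (inside (proj₁ z)))

    place : Fin k × Fin A → Fin n × Fin n
    place z = fromℕ< (col<n z) , fromℕ< (row<n z)

    cellOf-injective : Injective _≡_ _≡_ cellOf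
    cellOf-injective {a , t} {b , t′} eq
      -- The common cell lies in both tiles, so they coincide; only then can the indices `t` and
      -- `t′` be compared within one rectangle.
      with containing-tile-unique (contained (a , t))
             (subst (uncurry (ContainsCell (rect b))) (sym eq) (contained (b , t′)))
    ... | refl = cong (a ,_) (begin
      t   ≡⟨ Finₚ.cast-involutive (areas a) (sym (areas a)) t ⟨
      _   ≡⟨ cong (cast (areas a)) (cell-injective (rect a) eq) ⟩
      _   ≡⟨ Finₚ.cast-involutive (areas a) (sym (areas a)) t′ ⟩
      t′  ∎)
      where open ≡-Reasoning

    place-injective : Injective _≡_ _≡_ place
    place-injective {z} {z′} eq = cellOf-injective (cong₂ _,_
      (Finₚ.fromℕ<-injective _ _ (col<n z) (col<n z′) (proj₁ (,-injective eq)))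
      (Finₚ.fromℕ<-injective _ _ (row<n z) (row<n z′) (proj₂ (,-injective eq))))

    place-surjective : StrictlySurjective _≡_ place
    place-surjective (i , j) with covering (toℕ i) (toℕ j) (Finₚ.toℕ<n i) (Finₚ.toℕ<n j)
    ... | a , ∈a with cell-surjective (rect a) ∈a
    ...   | t , t↦ij = z , cong₂ _,_
      (Finₚ.toℕ-injective (trans (Finₚ.toℕ-fromℕ< (col<n z)) (cong proj₁ z↦ij)))
      (Finₚ.toℕ-injective (trans (Finₚ.toℕ-fromℕ< (row<n z)) (cong proj₂ z↦ij)))
      where
      z : Fin k × Fin A
      z = a , cast (areas a) t
      z↦ij : cellOf z ≡ (toℕ i , toℕ j)
      z↦ij = trans (cong (cell (rect a)) (Finₚ.cast-involutive (sym (areas a)) (areas a) t)) t↦ij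

  -- Equal areas and equal positive widths force equal heights, hence congruence without rotation,
  -- which distinct tiles exclude.
  perfect⇒width-injective : Perfect P → Injective _≡_ _≡_ (width ∘ rect)
  perfect⇒width-injective perfect {a} {b} w≡w′ = decidable-stable (a Finₚ.≟ b) λ a≢b →
    nonCongruent a b a≢b (inj₁ (w≡w′ , *-cancelˡ-≡ _ _ (width (rect a))
      {{>-nonZero (width>0 (rect a))}}
      (trans (perfect a b) (cong (_* height (rect b)) (sym w≡w′)))))

  -- Sending each tile to the position of its width in `xs` is injective, since the position
  -- determines the width and the width determines the tile.
  k≤length : ∀ {xs} → Perfect P → (∀ a → width (rect a) ∈ xs) → k ≤ length xs
  k≤length perfect w∈xs = Finₚ.injective⇒≤ {f = Any.index ∘ w∈xs} λ {a} {b} eq →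
    perfect⇒width-injective perfect
      (Membershipₚ.index-injective (setoid ℕ) (w∈xs a) (w∈xs b) eq)

-- The exponent is the number of prime factors of `n * n` with multiplicity, so the power of 2
-- bounds the number of its divisors.
largePrimeFactors⇒¬perfect : ∀ {n ps} → All Prime ps → All (2 ^ (length ps + length ps) <_) ps →
  n ≡ product ps → (P : MondrianPartition n) → ¬ Perfect P
largePrimeFactors⇒¬perfect {n} {ps} primes large n≡ P perfect =
  [ (λ k≡1 → <⇒≢ k≥2 (sym k≡1)) , ¬any∣k ]′ (∣product⇒≡1⊎any∣ primes² k∣product)
  where
  open MondrianPartition P
  qs = ps ++ ps
  primes² = Allₚ.++⁺ primes primes

  -- A reference tile, available because `k` is at least 2; its area serves as the common area.
  a₀ : Fin k
  a₀ = fromℕ< (<-trans (s≤s z≤n) k≥2)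

  A = area (rect a₀)

  k*A≡product : k * A ≡ product qs
  k*A≡product = trans (k*A≡n*n P (λ a → perfect a a₀))
    (trans (cong₂ _*_ n≡ n≡) (sym (product-++ ps ps)))

  width∣product : ∀ a → width (rect a) ∣ product qs
  width∣product a = ∣-trans (subst (width (rect a) ∣_) (perfect a a₀) (m∣m*n _))
    (subst (A ∣_) k*A≡product (n∣m*n k))

  k≤ : k ≤ 2 ^ (length ps + length ps)
  k≤ = subst (k ≤_) (trans (length-subproducts qs) (cong (2 ^_) (length-++ ps)))
    (k≤length P perfect (∣product⇒∈subproducts primes² ∘ width∣product))

  k∣product : k ∣ product qs
  k∣product = subst (k ∣_) k*A≡product (m∣m*n A)

  ¬any∣k : ¬ Any (_∣ k) qs
  -- A listed prime `q` dividing `k` satisfies `q ≤ k`, as `k` is nonzero, and so contradicts `k≤`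
  -- together with the lower bound on `q`.
  ¬any∣k any∣k with All.lookupAny (Allₚ.++⁺ large large) any∣k
  ... | large-q , q∣k = <⇒≱ large-q (≤-trans (∣⇒≤ {{Finₚ.nonZeroIndex a₀}} q∣k) k≤)

mainTheorem6 : ∀ (m : ℕ) (s : Fin (suc m) → ℕ) → (∀ i → 0 < s i) →
    ∃[ c ] (∀ (n : ℕ) (p : Fin (suc m) → ℕ) →
    (∀ i → Prime (p i)) →
    (∀ i j → i Fin.< j → p i < p j) →
    n ≡ primePowerProduct p s →
    c < p Fin.zero →
    ¬ (∃[ P ] Perfect {n} P))
-- The sum of the exponents is the length of `factors p s` for every `p`, so this constant is the
-- bound above, written without the primes.
mainTheorem6 m s s>0 = 2 ^ (foldr _+_ 0 s + foldr _+_ 0 s) , λ n p primes increasing n≡ c<p₀ (P , perfect) →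
  -- The constant is assumed to lie below the first prime only; monotonicity carries this to all the
  -- others.
  let p₀≤p : ∀ i → p Fin.zero ≤ p i
      p₀≤p = λ where
        Fin.zero    → ≤-refl
        (Fin.suc i) → <⇒≤ (increasing Fin.zero (Fin.suc i) (s≤s z≤n))
      bound≡ = cong (λ l → 2 ^ (l + l)) (length-factors p s)
  in largePrimeFactors⇒¬perfect (all-factors p s primes)
       (subst (λ b → All (b <_) (factors p s)) (sym bound≡)
         (all-factors p s (λ i → <-≤-trans c<p₀ (p₀≤p i))))
       (trans n≡ (sym (product-factors p s))) P perfect
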